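{- For every even integer $t \ge 4$, the sequence $\left(\left\lfloor n^t/24 \right\rfloor\right)_{n \ge 1}$ is eventually prime-free.
   Context: A sequence $(a_n)_{n\ge 1}$ of positive integers is called eventually prime-free if there exists an index $n_0$ such that $a_n$ is composite for all $n \ge n_0$. (Here, as in the paper, this is understood as: only finitely many terms $a_n$ are prime.) -}

module Defs where

open import Data.Nat using (ℕ; _≤_)
open import Data.Nat.Primality using (Composite)
open import Data.Product using (∃-syntax)

-- A sequence (aₙ)ₙ≥₁ is a function on ℕ whose value at 0 is ignored.
EventuallyPrimeFree : (ℕ → ℕ) → Set
EventuallyPrimeFree a = ∃[ n₀ ] (∀ n → 1 ≤ n → n₀ ≤ n → Composite (a n))

{-# OPTIONS --safe #-}
-- Modulo 24 every n satisfies n⁶ ≡ n⁴, so nᵗ ≡ n⁴ for all even t ≥ 4, and n⁴ leaves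
-- one of the square remainders 0, 1, 9, 16.  Writing t = 2s, m = nˢ and c² for the
-- remainder, 24 ⌊nᵗ/24⌋ = m² − c² = (m − c)(m + c).  Once both factors exceed 24, the
-- quotient cannot be prime: a prime would divide one factor, and the other would then
-- divide 24.
module Submission where

open import Data.Nat using (ℕ; suc; _+_; _*_; _∸_; _≤_; _<_; _^_; _/_; _%_; _≟_; z≤n; s≤s; NonZero; >-nonZero; n>1⇒nonTrivial)
open import Data.Nat.Divisibility using (_∣_; divides; ∣⇒≤; m∣m*n)
open import Data.Nat.DivMod using (m≡m%n+[m/n]*n; m%n<n; m%n%n≡m%n; %-distribˡ-*)
open import Data.Nat.Primality using (Prime; Composite; euclidsLemma; ¬prime⇒composite; prime⇒nonZero)
open import Data.Nat.Properties
open import Data.Nat.Tactic.RingSolver using (solve-∀)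
open import Data.Product using (∃-syntax; _×_; _,_)
open import Data.Sum using (inj₁; inj₂)
open import Relation.Binary.PropositionalEquality using (_≡_; refl; sym; trans; cong; cong₂; subst; module ≡-Reasoning)
open import Relation.Nullary using (¬_)
open import Relation.Nullary.Decidable using (from-yes)
open import Defs

*-cong-% : ∀ a a′ b b′ d .{{_ : NonZero d}} → a % d ≡ a′ % d → b % d ≡ b′ % d → (a * b) % d ≡ (a′ * b′) % d
*-cong-% a a′ b b′ d p q = begin
  (a * b) % d                 ≡⟨ %-distribˡ-* a b d ⟩
  ((a % d) * (b % d)) % d     ≡⟨ cong₂ (λ x y → (x * y) % d) p q ⟩
  ((a′ % d) * (b′ % d)) % d   ≡⟨ %-distribˡ-* a′ b′ d ⟨
  (a′ * b′) % d               ∎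
  where open ≡-Reasoning

^-cong-% : ∀ a a′ d .{{_ : NonZero d}} k → a % d ≡ a′ % d → (a ^ k) % d ≡ (a′ ^ k) % d
^-cong-% a a′ d 0 p = refl
^-cong-% a a′ d (suc k) p = *-cong-% a a′ (a ^ k) (a′ ^ k) d p (^-cong-% a a′ d k p)

n^k%d≡[n%d]^k%d : ∀ n k d .{{_ : NonZero d}} → (n ^ k) % d ≡ ((n % d) ^ k) % d
n^k%d≡[n%d]^k%d n k d = ^-cong-% n (n % d) d k (sym (m%n%n≡m%n n d))

-- Both 8 and 3 divide n⁴(n² - 1). Here the 24 residues are simply checked by evaluating a decision
-- procedure.
n^6≡n^4[mod24] : ∀ n → (n ^ 6) % 24 ≡ (n ^ 4) % 24
n^6≡n^4[mod24] n = begin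
  (n ^ 6) % 24          ≡⟨ n^k%d≡[n%d]^k%d n 6 24 ⟩
  ((n % 24) ^ 6) % 24   ≡⟨ from-yes (allUpTo? (λ r → (r ^ 6) % 24 ≟ (r ^ 4) % 24) 24) (m%n<n n 24) ⟩
  ((n % 24) ^ 4) % 24   ≡⟨ n^k%d≡[n%d]^k%d n 4 24 ⟨
  (n ^ 4) % 24          ∎
  where open ≡-Reasoning

-- Induction on `u`: two more factors n turn n⁴ into n⁶, which falls back to n⁴.
n^[4+2u]≡n^4[mod24] : ∀ n u → (n ^ (4 + u * 2)) % 24 ≡ (n ^ 4) % 24
n^[4+2u]≡n^4[mod24] n 0 = refl
n^[4+2u]≡n^4[mod24] n (suc u) = begin
  (n * (n * N)) % 24   ≡⟨ *-cong-% n n (n * N) (n ^ 5) 24 refl (*-cong-% n n N (n ^ 4) 24 refl (n^[4+2u]≡n^4[mod24] n u)) ⟩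
  (n ^ 6) % 24         ≡⟨ n^6≡n^4[mod24] n ⟩
  (n ^ 4) % 24         ∎
  where
  open ≡-Reasoning
  N = n ^ (4 + u * 2)

-- The remainder equals `c * c` exactly, not just modulo 24, so `c` is one of 0, 1, 3, 4. The bound
-- 5 makes the search finite and later yields the threshold 29.
n^4%24-square : ∀ n → ∃[ c ] (c < 5 × (n ^ 4) % 24 ≡ c * c)
n^4%24-square n
  with c , c<5 , eq ← from-yes (allUpTo? (λ r → anyUpTo? (λ c → (r ^ 4) % 24 ≟ c * c) 5) 24) (m%n<n n 24)
  = c , c<5 , trans (n^k%d≡[n%d]^k%d n 4 24) eq

-- With a = a′p, cancelling p leaves a′b = k, so b divides the nonzero k.
prime-divides-factor⇒cofactor≤ : ∀ {a b p k} .{{_ : NonZero k}} → Prime p → a * b ≡ p * k → p ∣ a → b ≤ k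
prime-divides-factor⇒cofactor≤ {b = b} {p} {k} pr ab≡pk (divides a′ refl) =
  ∣⇒≤ (divides a′ (sym (*-cancelˡ-≡ (a′ * b) k p eq)))
  where
  instance _ = prime⇒nonZero pr
  eq : p * (a′ * b) ≡ p * k
  eq = trans (sym (trans (cong (_* b) (*-comm a′ p)) (*-assoc p a′ b))) ab≡pk

large-factors⇒composite : ∀ {a b q k} .{{_ : NonZero k}} → k < a → k < b → a * b ≡ q * k → Composite q
large-factors⇒composite {a} {b} {q} {k} k<a k<b ab≡qk = ¬prime⇒composite {{n>1⇒nonTrivial 1<q}} ¬prime
  where
  -- Non-primality gives compositeness only once 0 and 1 are excluded.
  1<q : 1 < q
  1<q = *-cancelʳ-< k 1 q (begin-strict
    1 * k   ≤⟨ *-monoˡ-≤ k (≤-trans (s≤s z≤n) k<a) ⟩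
    a * k   <⟨ *-monoʳ-< a {{>-nonZero (≤-trans (s≤s z≤n) k<a)}} k<b ⟩
    a * b   ≡⟨ ab≡qk ⟩
    q * k   ∎)
    where open ≤-Reasoning
  ¬prime : ¬ Prime q
  ¬prime pr with euclidsLemma a b pr (subst (q ∣_) (sym ab≡qk) (m∣m*n k))
  ... | inj₁ q∣a = <⇒≱ k<b (prime-divides-factor⇒cofactor≤ pr ab≡qk q∣a)
  ... | inj₂ q∣b = <⇒≱ k<a (prime-divides-factor⇒cofactor≤ pr (trans (*-comm b a) ab≡qk) q∣b)

-- The difference of squares m² − c² = (m − c)(m + c) with m = c + d, free of subtraction.
difference-of-squares : ∀ c d → c * c + d * (c + c + d) ≡ (c + d) * (c + d)
difference-of-squares = solve-∀

square%k-square⇒composite : ∀ m c k .{{_ : NonZero k}} → c + k < m → (m ^ 2) % k ≡ c * c → Composite (m ^ 2 / k)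
square%k-square⇒composite m c k c+k<m rem = large-factors⇒composite k<d (≤-trans k<d (m≤n+m d (c + c))) factored
  where
  d = m ∸ c
  c≤m : c ≤ m
  c≤m = ≤-trans (m≤m+n c k) (<⇒≤ c+k<m)
  k<d : k < d
  k<d = m+n≤o⇒m≤o∸n (suc k) (subst (_≤ m) (cong suc (+-comm c k)) c+k<m)
  factored : d * (c + c + d) ≡ m ^ 2 / k * k
  -- After adding c², both sides equal m²: the left by the difference of squares, the right by
  -- division with remainder.
  factored = +-cancelˡ-≡ (c * c) _ _ (begin
    c * c + d * (c + c + d)       ≡⟨ difference-of-squares c d ⟩
    (c + d) * (c + d)             ≡⟨ cong (λ x → x * x) (m+[n∸m]≡n c≤m) ⟩
    m * m                         ≡⟨ cong (m *_) (*-identityʳ m) ⟨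
    m ^ 2                         ≡⟨ m≡m%n+[m/n]*n (m ^ 2) k ⟩
    (m ^ 2) % k + m ^ 2 / k * k   ≡⟨ cong (_+ m ^ 2 / k * k) rem ⟩
    c * c + m ^ 2 / k * k         ∎)
    where open ≡-Reasoning

theorem6 : (t : ℕ) → 2 ∣ t → 4 ≤ t → EventuallyPrimeFree (λ n → n ^ t / 24)
theorem6 _ (divides 0 refl) ()
theorem6 _ (divides 1 refl) (s≤s (s≤s ()))
-- 29 = 5 + 24: from c < 5 follows c + 24 < 29 ≤ n ≤ nˢ, so already nˢ - c exceeds 24.
theorem6 _ (divides (suc (suc u)) refl) _ = 29 , composite
  where
  s = 2 + u
  composite : ∀ n → 1 ≤ n → 29 ≤ n → Composite (n ^ (s * 2) / 24)
  composite n 1≤n 29≤n with c , c<5 , eq ← n^4%24-square n =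
    subst (λ x → Composite (x / 24)) (^-*-assoc n s 2)
      (square%k-square⇒composite (n ^ s) c 24 c+24<m
        -- `s * 2` computes to `4 + u * 2`, so the congruence for that exponent applies directly.
        (trans (cong (_% 24) (^-*-assoc n s 2)) (trans (n^[4+2u]≡n^4[mod24] n u) eq)))
    where
    c+24<m : c + 24 < n ^ s
    c+24<m = begin-strict
      c + 24   <⟨ +-monoˡ-< 24 c<5 ⟩
      29       ≤⟨ 29≤n ⟩
      n        ≡⟨ ^-identityʳ n ⟨
      n ^ 1    ≤⟨ ^-monoʳ-≤ n {{>-nonZero 1≤n}} (s≤s (z≤n {suc u})) ⟩
      n ^ s    ∎
      where open ≤-Reasoning
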